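{- Let $m\ge 3$ be an integer, let $D\subset\{0,1,\dots,m-1\}$ with $1<\#D<m$, and let $K_{m,D}$ be the associated missing-digit set. Let $a_n=\prod_{k=1}^n (m^k-1)$ for $n\in\mathbb{N}$. Then the intersection $\left\{\frac{1}{a_n}:n\in\mathbb{N}\right\}\cap K_{m,D}$ is finite.
   Context: $\mathbb{N}=\{1,2,3,\dots\}$. The missing-digit set is $K_{m,D}:=\left\{\sum_{j=1}^\infty \frac{b_j}{m^j}: b_j\in D\text{ for all }j\ge 1\right\}\subset[0,1]$. -}

module Defs where

open import Data.Fin.Base using (Fin; toℕ)
open import Data.Fin.Subset using (Subset; _∈_)
open import Data.Integer.Base using (+_)
open import Data.List.Base using (List)
import Data.List.Membership.Propositional as List
open import Data.Nat.Base using (ℕ; zero; suc; _*_; _∸_; _^_; _≤_; _≥_; NonZero; NonTrivial; nonTrivial⇒nonZero; nonTrivial⇒n>1; >-nonZero)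
open import Data.Nat.Properties using (m*n≢0; m^n≢0; m^n>0; m<n⇒0<n∸m; *-mono-≤)
open import Data.Product.Base using (∃-syntax; Σ-syntax; _×_)
open import Data.Rational.Base as ℚ using (ℚ; 0ℚ; _/_)
open import Function.Bundles using (_⇔_)
open import Level using (Level; 0ℓ; _⊔_)
open import Relation.Binary.PropositionalEquality.Core using (_≡_)
open import Relation.Unary using (Pred)

private
  variable
    a p : Level

-- The subset is exactly the set of entries of a list.  This is stronger
-- constructively than being contained in a list.
Finite : {A : Set a} → Pred A p → Set (a ⊔ p)
Finite {A = A} P = ∃[ xs ] (∀ (x : A) → P x ⇔ x List.∈ xs)

-- f 1 + ... + f n; the value f 0 is not used.
partialSum : (ℕ → ℚ) → ℕ → ℚ
partialSum f zero    = 0ℚ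
partialSum f (suc n) = partialSum f n ℚ.+ f (suc n)

_⟶_ : (ℕ → ℚ) → ℚ → Set
s ⟶ x = ∀ ε → 0ℚ ℚ.< ε → ∃[ N ] (∀ n → n ≥ N → ℚ.∣ s n ℚ.- x ∣ ℚ.< ε)

infix 4 _⟶_

module _ (m : ℕ) .{{_ : NonTrivial m}} where

  -- The term d / mʲ.
  digitTerm : Fin m → ℕ → ℚ
  digitTerm d j = _/_ (+ toℕ d) (m ^ j) {{m^n≢0 m j {{nonTrivial⇒nonZero m}}}}

  -- The rational points of the missing-digit set: those x in ℚ that are the
  -- sum of a series ∑_{j ≥ 1} b j / mʲ with all digits b j in D.
  K : Subset m → Pred ℚ 0ℓ
  K D x = Σ[ b ∈ (ℕ → Fin m) ] (∀ j → 1 ≤ j → b j ∈ D) × (partialSum (λ j → digitTerm (b j) j) ⟶ x)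

  -- ∏_{k = 1}^{n} (mᵏ - 1); the truncated subtraction is exact since mᵏ ≥ 1.
  aₙ : ℕ → ℕ
  aₙ zero    = 1
  aₙ (suc n) = aₙ n * (m ^ suc n ∸ 1)

  m^[1+n]∸1≢0 : ∀ n → NonZero (m ^ suc n ∸ 1)
  m^[1+n]∸1≢0 n = >-nonZero (m<n⇒0<n∸m
    (*-mono-≤ (nonTrivial⇒n>1 m) (m^n>0 m {{nonTrivial⇒nonZero m}} n)))

  aₙ≢0 : ∀ n → NonZero (aₙ n)
  aₙ≢0 zero    = _
  aₙ≢0 (suc n) = m*n≢0 (aₙ n) (m ^ suc n ∸ 1) {{aₙ≢0 n}} {{m^[1+n]∸1≢0 n}}

  -- { 1 / aₙ : n ≥ 1 }
  Reciprocals : Pred ℚ 0ℓ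
  Reciprocals x = ∃[ n ] 1 ≤ n × x ≡ _/_ (+ 1) (aₙ n) {{aₙ≢0 n}}

{-# OPTIONS --safe #-}

-- Since a = aₙ is coprime to m, the digits of 1/a are read off the residues of the
-- powers of m modulo a.  Fix a prime p dividing m - 1.  As h = m^(n!) - 1 satisfies
-- aₙ ∣ hⁿ, a power of m^(n!) with exponent prime to p is 1 modulo the p-free part of aₙ.
-- Multiplying the exponent by p raises the p-adic valuation of mᵀ - 1 by exactly one,
-- while aₙ is divisible by pⁿ times the p-part of n!.  So for n large there is T for
-- which mᵀ - 1 contains all of aₙ except for a prescribed factor pʳ.  The powers of mᵀ
-- then run through an arithmetic progression modulo aₙ of step aₙ / pʳ, and once
-- pʳ > 2m every digit occurs in 1/aₙ.  For the remaining n membership is decidable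
-- because the digits are periodic.
module Submission where

open import Defs
open import Algebra.Properties.Group using (//-rightDividesˡ; //-rightDividesʳ; ⁻¹-anti-homo-//)
open import Data.Fin.Base using (Fin; toℕ)
open import Data.Fin.Properties using (toℕ-fromℕ<; toℕ-injective; toℕ<n; ¬∀⟶∃¬)
open import Data.Fin.Subset using (Subset; _∈_; ∣_∣; ⊤)
open import Data.Fin.Subset.Properties using (_∈?_; p⊆q⇒∣p∣≤∣q∣; ∣⊤∣≡n)
open import Data.Integer.Base as ℤ using (+_; +[1+_])
import Data.Integer.Properties as ℤ
open import Data.List.Base using ([]; _∷_; map; filter; upTo)
import Data.List.Membership.Propositional as List
open import Data.List.Membership.Propositional.Properties
  using (∈-map⁺; ∈-map⁻; ∈-filter⁺; ∈-filter⁻; ∈-upTo⁺)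
open import Data.List.Relation.Unary.All using (_∷_)
open import Data.Nat.Base
open import Data.Nat.Coprimality using (Coprime; coprime-Bézout)
open import Data.Nat.Divisibility
open import Data.Nat.DivMod hiding (result)
open import Data.Nat.GCD using (module Bézout)
open import Data.Nat.Induction using (<-rec)
open import Data.Nat.Primality using (Prime; euclidsLemma; prime⇒nonZero; prime⇒nonTrivial)
open import Data.Nat.Primality.Factorisation using (PrimeFactorisation; factorise)
open import Data.Nat.Properties
open import Data.Nat.Tactic.RingSolver using (solve-∀)
open import Data.Product.Base using (∃-syntax; _×_; _,_)
open import Data.Rational.Base as ℚ using (ℚ; mkℚ; 0ℚ; *<*)
import Data.Rational.Properties as ℚ
open import Data.Rational.Unnormalised.Base as ℚᵘ using (mkℚᵘ; *≤*)
import Data.Rational.Unnormalised.Properties as ℚᵘ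
open import Data.Sum.Base using (inj₁; inj₂; [_,_]′)
open import Function.Base using (_∘_; it)
open import Function.Bundles using (mk⇔)
open import Level using (0ℓ)
open import Relation.Binary.PropositionalEquality
open import Relation.Nullary using (Dec; ¬_; yes; no; contradiction)
open import Relation.Nullary.Decidable using (map′)
open import Relation.Unary using (Pred; _∩_)

-- Binomial expansion, linear congruences and powers.

-- Second-order form of the binomial theorem: everything past the linear term is collected as one
-- multiple of h².
binomial-expansion : ∀ h t → ∃[ c ] (1 + h) ^ t ≡ 1 + h * (t + h * c)
binomial-expansion h zero    = 0 , lemma h
  where
  lemma : ∀ h → 1 ≡ 1 + h * (0 + h * 0)
  lemma = solve-∀
binomial-expansion h (suc t) with c , eq ← binomial-expansion h t =
  c + t + h * c , trans (cong ((1 + h) *_) eq) (lemma h t c)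
  where
  lemma : ∀ h t c → (1 + h) * (1 + h * (t + h * c)) ≡ 1 + h * (1 + t + h * (c + t + h * c))
  lemma = solve-∀

-- The congruence t z ≡ k (mod P) is written without subtraction, with a multiple of P on each side.
-- The solution t is k times an inverse of z obtained from Bézout.
solve-linear-congruence : ∀ {z P} → Coprime z P → ∀ k →
  ∃[ t ] ∃[ y′ ] ∃[ y ] t * z + y′ * P ≡ k + y * P
solve-linear-congruence {z} {P} z⊥P k with coprime-Bézout z⊥P
... | Bézout.+- x y eq = k * x , 0 , k * y , (begin
  k * x * z + 0 * P   ≡⟨ lemma₁ k x z P ⟩
  k * (x * z)         ≡⟨ cong (k *_) eq ⟨
  k * (1 + y * P)     ≡⟨ lemma₂ k y P ⟩
  k + k * y * P       ∎)
  where
  open ≡-Reasoning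
  lemma₁ : ∀ k x z P → k * x * z + 0 * P ≡ k * (x * z)
  lemma₁ = solve-∀
  lemma₂ : ∀ k y P → k * (1 + y * P) ≡ k + k * y * P
  lemma₂ = solve-∀
-- Here x z ≡ -1 (mod P), so x² z is the inverse of z.
... | Bézout.-+ x y eq = k * x * x * z , k * y , k * x * z * y , (begin
  k * x * x * z * z + k * y * P               ≡⟨ lemma₁ k x z y P ⟩
  k * (x * z * (x * z) + y * P)               ≡⟨ cong (λ u → k * (x * z * (x * z) + u)) eq ⟨
  k * (x * z * (x * z) + (1 + x * z))         ≡⟨ lemma₂ k x z ⟩
  k + k * x * z * (1 + x * z)                 ≡⟨ cong (λ u → k + k * x * z * u) eq ⟩
  k + k * x * z * (y * P)                     ≡⟨ cong (λ u → k + u) (*-assoc (k * x * z) y P) ⟨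
  k + k * x * z * y * P                       ∎)
  where
  open ≡-Reasoning
  lemma₁ : ∀ k x z y P → k * x * x * z * z + k * y * P ≡ k * (x * z * (x * z) + y * P)
  lemma₁ = solve-∀
  lemma₂ : ∀ k x z → k * (x * z * (x * z) + (1 + x * z)) ≡ k + k * x * z * (1 + x * z)
  lemma₂ = solve-∀

^-distribʳ-* : ∀ n a b → (a * b) ^ n ≡ a ^ n * b ^ n
^-distribʳ-* zero    a b = refl
^-distribʳ-* (suc n) a b = trans (cong (a * b *_) (^-distribʳ-* n a b)) (lemma a b (a ^ n) (b ^ n))
  where
  lemma : ∀ a b x y → a * b * (x * y) ≡ a * x * (b * y)
  lemma = solve-∀

^-monoʳ-∣ : ∀ a {k n} → k ≤ n → a ^ k ∣ a ^ n
^-monoʳ-∣ a {n = n} z≤n = 1∣ (a ^ n)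
^-monoʳ-∣ a (s≤s k≤n)   = *-monoʳ-∣ a (^-monoʳ-∣ a k≤n)

n<a^n : ∀ {a} → 1 < a → ∀ n → n < a ^ n
n<a^n 1<a zero    = s≤s z≤n
n<a^n {a} 1<a (suc n) = begin-strict
  suc n        ≤⟨ n<a^n 1<a n ⟩
  a ^ n        <⟨ ^-monoʳ-< a 1<a (n<1+n n) ⟩
  a ^ suc n    ∎
  where open ≤-Reasoning

-- Valuation at a prime.

-- The p-adic valuation as a relation, which keeps the cofactor prime to p at hand.
Exactly : ℕ → ℕ → ℕ → Set
Exactly p v n = ∃[ w ] n ≡ p ^ v * w × p ∤ w

module _ {p : ℕ} (pr : Prime p) where

  private instance
    p≢0 : NonZero p
    p≢0 = prime⇒nonZero pr

    p-nonTrivial : NonTrivial p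
    p-nonTrivial = prime⇒nonTrivial pr

  ∤-* : ∀ {a b} → p ∤ a → p ∤ b → p ∤ a * b
  ∤-* p∤a p∤b = [ p∤a , p∤b ]′ ∘ euclidsLemma _ _ pr

  ∤-1 : p ∤ 1
  ∤-1 p∣1 = nonTrivial⇒≢1 (∣1⇒≡1 p∣1)

  ∤-^ : ∀ {a} → p ∤ a → ∀ n → p ∤ a ^ n
  ∤-^ p∤a zero    = ∤-1
  ∤-^ p∤a (suc n) = ∤-* p∤a (∤-^ p∤a n)

  ∤-+ : ∀ {a b} → p ∤ a → p ∣ b → p ∤ a + b
  ∤-+ {a} {b} p∤a p∣b p∣a+b = p∤a (∣m+n∣m⇒∣n (subst (p ∣_) (+-comm a b) p∣a+b) p∣b)

  Exactly-* : ∀ u v {a b} → Exactly p u a → Exactly p v b → Exactly p (u + v) (a * b)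
  Exactly-* u v (x , refl , p∤x) (y , refl , p∤y) = x * y , eq , ∤-* p∤x p∤y
    where
    lemma : ∀ P Q x y → P * x * (Q * y) ≡ P * Q * (x * y)
    lemma = solve-∀
    eq : p ^ u * x * (p ^ v * y) ≡ p ^ (u + v) * (x * y)
    eq = trans (lemma (p ^ u) (p ^ v) x y) (cong (_* (x * y)) (sym (^-distribˡ-+-* p u v)))

  valuation : ∀ n .{{_ : NonZero n}} → ∃[ v ] Exactly p v n
  valuation n {{n≢0}} = <-rec (λ n → .(NonZero n) → ∃[ v ] Exactly p v n) step n n≢0
    where
    step : ∀ n → (∀ {k} → k < n → .(NonZero k) → ∃[ v ] Exactly p v k) →
           .(NonZero n) → ∃[ v ] Exactly p v n
    step n rec n≢0 with p ∣? n
    ... | no p∤n  = 0 , n , sym (+-identityʳ n) , p∤n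
    ... | yes p∣n
      with v , w , q≡ , p∤w ← rec (quotient-< p∣n {{p-nonTrivial}} {{n≢0}}) (quotient≢0 p∣n {{n≢0}}) =
      suc v , w
      , trans (m∣n⇒n≡m*quotient p∣n) (trans (cong (p *_) q≡) (sym (*-assoc p (p ^ v) w)))
      , p∤w

  -- The form `k + v` has the lower bound built in, so that no truncated subtraction arises later.
  valuation-≥ : ∀ k {n} → .(NonZero n) → p ^ k ∣ n → ∃[ v ] Exactly p (k + v) n
  valuation-≥ k {n} n≢0 p^k∣n
    with v , w , q≡ , p∤w ← valuation (quotient p^k∣n) {{quotient≢0 p^k∣n {{n≢0}}}}
    = v , w , eq , p∤w
    where
    open ≡-Reasoning
    eq : n ≡ p ^ (k + v) * w
    eq = begin
      n                          ≡⟨ m∣n⇒n≡m*quotient p^k∣n ⟩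
      p ^ k * quotient p^k∣n     ≡⟨ cong (p ^ k *_) q≡ ⟩
      p ^ k * (p ^ v * w)        ≡⟨ *-assoc (p ^ k) (p ^ v) w ⟨
      p ^ k * p ^ v * w          ≡⟨ cong (_* w) (^-distribˡ-+-* p k v) ⟨
      p ^ (k + v) * w            ∎

  -- Factors p are cancelled one at a time: in p y = q b, Euclid's lemma puts p into q because p ∤
  -- b.
  ∣p^k*x⇒∣x : ∀ {b} → p ∤ b → ∀ k {x} → b ∣ p ^ k * x → b ∣ x
  ∣p^k*x⇒∣x p∤b zero    {x} b∣ = subst (_ ∣_) (*-identityˡ x) b∣
  ∣p^k*x⇒∣x {b} p∤b (suc k) {x} b∣ =
    ∣p^k*x⇒∣x p∤b k (cancel (subst (b ∣_) (*-assoc p (p ^ k) x) b∣))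
    where
    cancel : ∀ {y} → b ∣ p * y → b ∣ y
    cancel {y} (divides q eq) with euclidsLemma q b pr (divides y (trans (sym eq) (*-comm p y)))
    ... | inj₂ p∣b = contradiction p∣b p∤b
    ... | inj₁ (divides q′ refl) = divides q′ (*-cancelˡ-≡ _ _ p (trans eq (lemma q′ p b)))
      where
      lemma : ∀ q p b → q * p * b ≡ p * (q * b)
      lemma = solve-∀

  -- A common divisor of z and pʳ is prime to p, so cancelling pʳ leaves it a divisor of 1.
  ∤⇒coprime-^ : ∀ {z} → p ∤ z → ∀ r → Coprime z (p ^ r)
  ∤⇒coprime-^ p∤z r (d∣z , d∣p^r) =
    ∣1⇒≡1 (∣p^k*x⇒∣x (λ p∣d → p∤z (∣-trans p∣d d∣z)) r (∣m⇒∣m*n 1 d∣p^r))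

-- Quotients, and divisibility properties of mᵀ - 1.

[x/a]-unique : ∀ {x d} a .{{_ : NonZero a}} → d * a ≤ x → x < suc d * a → x / a ≡ d
[x/a]-unique {x} {d} a lo hi = ≤-antisym
  (s≤s⁻¹ (m<n*o⇒m/o<n {n = suc d} hi))
  (subst (_≤ x / a) (m*n/n≡m d a) (/-monoˡ-≤ a lo))

module _ (m : ℕ) .{{_ : NonTrivial m}} where

  private instance
    m≢0 : NonZero m
    m≢0 = nonTrivial⇒nonZero m

  ρ : ℕ → ℕ
  ρ T = m ^ T ∸ 1

  1+ρ : ∀ T → 1 + ρ T ≡ m ^ T
  1+ρ T = m+[n∸m]≡n (m^n>0 m T)

  ρ≢0 : ∀ T .{{_ : NonZero T}} → NonZero (ρ T)
  ρ≢0 (suc T) = m^[1+n]∸1≢0 m T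

  -- Expands (1 + `ρ T`)ᵗ. The cofactor is congruent to t modulo `ρ T`, which is what governs the
  -- change of valuation.
  ρ-* : ∀ T t → ∃[ c ] ρ (T * t) ≡ ρ T * (t + ρ T * c)
  ρ-* T t with c , eq ← binomial-expansion (ρ T) t = c , suc-injective (begin
    1 + ρ (T * t)                ≡⟨ 1+ρ (T * t) ⟩
    m ^ (T * t)                  ≡⟨ ^-*-assoc m T t ⟨
    (m ^ T) ^ t                  ≡⟨ cong (_^ t) (1+ρ T) ⟨
    (1 + ρ T) ^ t                ≡⟨ eq ⟩
    1 + ρ T * (t + ρ T * c)      ∎)
    where open ≡-Reasoning

  ρ-mono-∣ : ∀ S T → S ∣ T → ρ S ∣ ρ T
  ρ-mono-∣ S T (divides q refl) with c , eq ← ρ-* S q =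
    subst (ρ S ∣_) (trans (sym eq) (cong ρ (*-comm S q))) (m∣m*n _)

  -- Raising to the d-th power multiplies mᵀ - 1 by a number divisible by d.
  *-∣ρ : ∀ {d e} T → d ∣ ρ T → e ∣ ρ T → e * d ∣ ρ (T * d)
  *-∣ρ {d} {e} T d∣ e∣ with c , eq ← ρ-* T d =
    subst (e * d ∣_) (sym eq) (*-pres-∣ e∣ (∣m∣n⇒∣m+n ∣-refl (∣m⇒∣m*n c d∣)))

  -- Iterates `*-∣ρ`: every further factor d in the exponent of m gains a factor d in mᵀ - 1.
  ^∣ρ : ∀ {d} T → d ∣ ρ T → ∀ k → d ^ suc k ∣ ρ (T * d ^ k)
  ^∣ρ {d} T d∣ zero    = subst₂ _∣_ (sym (*-identityʳ d)) (cong ρ (sym (*-identityʳ T))) d∣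
  ^∣ρ {d} T d∣ (suc k) =
    subst₂ _∣_ (*-comm (d ^ suc k) d) (cong ρ (lemma T d (d ^ k)))
      (*-∣ρ (T * d ^ k) (∣-trans d∣ (ρ-mono-∣ T _ (m∣m*n (d ^ k)))) (^∣ρ T d∣ k))
    where
    lemma : ∀ T d e → T * e * d ≡ T * (d * e)
    lemma = solve-∀

  -- Each factor mᵏ - 1 with 1 ≤ k ≤ n divides `ρ Q`, since k divides n!. Allowing any multiple `Q`
  -- of n! keeps `Q` fixed during the induction.
  aₙ∣ρ^n : ∀ n {Q} → n ! ∣ Q → aₙ m n ∣ ρ Q ^ n
  aₙ∣ρ^n zero    _    = ∣-refl
  aₙ∣ρ^n (suc n) {Q} n!∣Q = subst (aₙ m (suc n) ∣_) (*-comm (ρ Q ^ n) (ρ Q))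
    (*-pres-∣ (aₙ∣ρ^n n (m*n∣⇒n∣ (suc n) (n !) n!∣Q))
      (ρ-mono-∣ (suc n) Q (m*n∣⇒m∣ (suc n) (n !) n!∣Q)))

  -- Adding y a to M adds m y to the quotient, which vanishes modulo m. For M = mᴺ this reads a
  -- digit of 1/a off the residue of mᴺ modulo a.
  digit-≡-mod : ∀ {M R} y y′ a .{{_ : NonZero a}} → M + y′ * a ≡ R + y * a →
    (m * M / a) % m ≡ (m * R / a) % m
  digit-≡-mod {M} {R} y y′ a eq = begin
    (m * M / a) % m                 ≡⟨ %-remove-+ʳ (m * M / a) {d = m} (m∣m*n y′) ⟨
    (m * M / a + m * y′) % m        ≡⟨ cong (_% m) (shift M y′) ⟨
    (m * (M + y′ * a) / a) % m      ≡⟨ cong (λ u → (m * u / a) % m) eq ⟩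
    (m * (R + y * a) / a) % m       ≡⟨ cong (_% m) (shift R y) ⟩
    (m * R / a + m * y) % m         ≡⟨ %-remove-+ʳ (m * R / a) {d = m} (m∣m*n y) ⟩
    (m * R / a) % m                 ∎
    where
    open ≡-Reasoning
    lemma : ∀ m X y a → m * (X + y * a) ≡ m * X + m * y * a
    lemma = solve-∀
    shift : ∀ X y → m * (X + y * a) / a ≡ m * X / a + m * y
    shift X y = begin
      m * (X + y * a) / a              ≡⟨ cong (_/ a) (lemma m X y a) ⟩
      (m * X + m * y * a) / a          ≡⟨ +-distrib-/-∣ʳ (m * X) (n∣m*n (m * y)) ⟩
      m * X / a + m * y * a / a        ≡⟨ cong (λ u → m * X / a + u) (m*n/n≡m (m * y) a) ⟩
      m * X / a + m * y                ∎

  -- Modulo a = g pʳ the powers of mᵀ = 1 + g z are exactly the residues 1 + k g: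
  -- (mᵀ)ᵗ ≡ 1 + t g z because a ∣ g², and z is a unit modulo pʳ.
  Splitting : ℕ → ℕ → ℕ → Set
  Splitting p a r = ∃[ T ] ∃[ g ] ∃[ z ] a ≡ g * p ^ r × ρ T ≡ g * z × p ∤ z × p ^ r ∣ g

  -- Lifting the exponent at a prime dividing m - 1.

  module _ {p : ℕ} (pr : Prime p) (p∣m-1 : p ∣ ρ 1) where

    private instance
      p≢0′ : NonZero p
      p≢0′ = prime⇒nonZero pr

    -- As p divides `ρ T`, the cofactor t + `ρ T` c is congruent to t modulo p, hence prime to p.
    Exactly-ρ-*-coprime : ∀ {v t} T → 1 ≤ v → p ∤ t → Exactly p v (ρ T) → Exactly p v (ρ (T * t))
    Exactly-ρ-*-coprime {suc v} {t} T (s≤s _) p∤t (w , ρ≡ , p∤w) with c , eq ← ρ-* T t =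
      w * (t + ρ T * c)
      , trans eq (trans (cong (_* (t + ρ T * c)) ρ≡) (*-assoc (p ^ suc v) w _))
      , ∤-* pr p∤w (∤-+ pr p∤t (∣m⇒∣m*n c (subst (p ∣_) (sym ρ≡) (∣m⇒∣m*n w (m∣m*n (p ^ v))))))

    -- For p = 2 this fails at v = 1: 3 - 1 = 2, but 3² - 1 = 8.
    Exactly-ρ-*-p : ∀ {v} T → 2 ≤ v → Exactly p v (ρ T) → Exactly p (suc v) (ρ (T * p))
    Exactly-ρ-*-p {suc (suc v)} T (s≤s (s≤s _)) (w , ρ≡ , p∤w) with c , eq ← ρ-* T p =
      w * (1 + p * q)
      , trans eq (trans (cong (λ r → r * (p + r * c)) ρ≡) (lemma p (p ^ v) w c))
      , ∤-* pr p∤w (∤-+ pr (∤-1 pr) (m∣m*n q))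
      where
      q : ℕ
      q = p ^ v * w * c
      lemma : ∀ p P w c → p * (p * P) * w * (p + p * (p * P) * w * c)
                        ≡ p * (p * (p * P)) * (w * (1 + p * (P * w * c)))
      lemma = solve-∀

    Exactly-ρ-*-p^ : ∀ {v} T → 2 ≤ v → Exactly p v (ρ T) → ∀ i → Exactly p (i + v) (ρ (T * p ^ i))
    Exactly-ρ-*-p^ {v} T 2≤v ex zero    = subst (Exactly p v ∘ ρ) (sym (*-identityʳ T)) ex
    Exactly-ρ-*-p^ {v} T 2≤v ex (suc i) = subst (Exactly p (suc i + v) ∘ ρ) (lemma T p (p ^ i))
      (Exactly-ρ-*-p (T * p ^ i) (≤-trans 2≤v (m≤n+m v i)) (Exactly-ρ-*-p^ T 2≤v ex i))
      where
      lemma : ∀ T p e → T * e * p ≡ T * (p * e)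
      lemma = solve-∀

    p^[1+k]∣ρ[p^k] : ∀ k → p ^ suc k ∣ ρ (p ^ k)
    p^[1+k]∣ρ[p^k] k = subst (λ T → p ^ suc k ∣ ρ T) (*-identityˡ (p ^ k)) (^∣ρ 1 p∣m-1 k)

    -- If k = pᶠ t, then m^(pᶠ) - 1 divides mᵏ - 1 and is divisible by p^(f + 1). So each factor of
    -- aₙ contributes p times the p-part of its index.
    p^n*n!-part∣aₙ : ∀ n → ∃[ e ] Exactly p e (n !) × p ^ (n + e) ∣ aₙ m n
    p^n*n!-part∣aₙ zero = 0 , (1 , refl , ∤-1 pr) , ∣-refl
    p^n*n!-part∣aₙ (suc n)
      with e , ex , p^∣aₙ ← p^n*n!-part∣aₙ n
      with f , ex′@(t , 1+n≡ , _) ← valuation pr (suc n)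
      = f + e , Exactly-* pr f e ex′ ex
      , subst (_∣ aₙ m (suc n)) eq (*-pres-∣ p^∣aₙ
          (∣-trans (p^[1+k]∣ρ[p^k] f) (ρ-mono-∣ _ (suc n) (subst (p ^ f ∣_) (sym 1+n≡) (m∣m*n t)))))
      where
      lemma : ∀ n e f → n + e + suc f ≡ suc n + (f + e)
      lemma = solve-∀
      eq : p ^ (n + e) * p ^ suc f ≡ p ^ (suc n + (f + e))
      eq = trans (sym (^-distribˡ-+-* p (n + e) (suc f))) (cong (p ^_) (lemma n e f))

    -- Starting from the exponent p secures valuation at least 2, so that `Exactly-ρ-*-p` applies
    -- for p = 2 as well.
    p²∣ρ[p] : p ^ 2 ∣ ρ p
    p²∣ρ[p] = subst (λ T → p ^ 2 ∣ ρ T) (^-identityʳ p) (p^[1+k]∣ρ[p^k] 1)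

    -- Takes g = p^S b. Since p^S is the whole p-part of `ρ T`, the quotient z of `ρ T` by g is
    -- prime to p, and r ≤ S gives pʳ ∣ g.
    splitting-intro : ∀ {a b} S r T → p ∤ b → a ≡ p ^ (S + r) * b → r ≤ S →
      Exactly p S (ρ T) → b ∣ ρ T → Splitting p a r
    splitting-intro {a} {b} S r T p∤b a≡ r≤S (w , ρT≡ , p∤w) b∣ρT = T , p ^ S * b , quotient b∣w
      , trans a≡ (trans (cong (_* b) (^-distribˡ-+-* p S r)) (lemma (p ^ S) (p ^ r) b))
      , trans ρT≡ (trans (cong (p ^ S *_) (m∣n⇒n≡m*quotient b∣w))
          (sym (*-assoc (p ^ S) b (quotient b∣w))))
      , (λ p∣z → p∤w (∣-trans p∣z (quotient-∣ b∣w)))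
      , ∣m⇒∣m*n b (^-monoʳ-∣ p r≤S)
      where
      b∣w : b ∣ w
      b∣w = ∣p^k*x⇒∣x pr p∤b S (subst (b ∣_) ρT≡ b∣ρT)
      lemma : ∀ P R b → P * R * b ≡ P * b * R
      lemma = solve-∀

    -- Being prime to p and a divisor of `ρ (n !)`ⁿ, b divides uⁿ, and `^∣ρ` puts u^(n + 1) into the
    -- value of `ρ`. In the application u is prime to p, so the extra exponent uⁿ leaves the p-adic
    -- valuation unchanged.
    coprime-part-∣ρ : ∀ n {b} v f u → p ∤ b → aₙ m n ≡ p ^ v * b → ρ (n !) ≡ p ^ f * u →
      b ∣ ρ (n ! * u ^ n)
    coprime-part-∣ρ n {b} v f u p∤b aₙ≡ ρ[n!]≡ = ∣-trans b∣u^n (∣-trans (n∣m*n u) u^1+n∣ρ)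
      where
      eq : ρ (n !) ^ n ≡ p ^ (f * n) * u ^ n
      eq = begin
        ρ (n !) ^ n              ≡⟨ cong (_^ n) ρ[n!]≡ ⟩
        (p ^ f * u) ^ n          ≡⟨ ^-distribʳ-* n (p ^ f) u ⟩
        (p ^ f) ^ n * u ^ n      ≡⟨ cong (_* u ^ n) (^-*-assoc p f n) ⟩
        p ^ (f * n) * u ^ n      ∎
        where open ≡-Reasoning
      b∣u^n : b ∣ u ^ n
      b∣u^n = ∣p^k*x⇒∣x pr p∤b (f * n) (subst (b ∣_) eq
        (∣-trans (subst (b ∣_) (sym aₙ≡) (n∣m*n (p ^ v))) (aₙ∣ρ^n n ∣-refl)))
      u^1+n∣ρ : u ^ suc n ∣ ρ (n ! * u ^ n)
      u^1+n∣ρ = ^∣ρ (n !) (subst (u ∣_) (sym ρ[n!]≡) (n∣m*n (p ^ f))) n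

    aₙ-splitting : ∀ r → ∃[ N ] ∀ n → N ≤ n → Splitting p (aₙ m n) r
    aₙ-splitting r = bound (valuation-≥ pr 2 (ρ≢0 p) p²∣ρ[p])
      where
      -- Here 2 + v is the valuation of `ρ p`. One r in the bound makes the subtraction in `o`
      -- exact, the other gives r ≤ `o`, hence r ≤ `S` below.
      module _ (v : ℕ) (ρ[p] : Exactly p (2 + v) (ρ p)) (n : ℕ) (N≤n : 2 + v + (r + r) ≤ n) where

        o : ℕ
        o = n ∸ (2 + v + r)

        r+≤n : r + (2 + v + r) ≤ n
        r+≤n = subst (_≤ n) (lemma v r) N≤n
          where
          lemma : ∀ v r → 2 + v + (r + r) ≡ r + (2 + v + r)
          lemma = solve-∀

        o+≡n : o + (2 + v + r) ≡ n
        o+≡n = m∸n+n≡m (≤-trans (m≤n+m _ r) r+≤n)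

        assemble : ∀ e v′ f → Exactly p e (n !) → Exactly p (n + e + v′) (aₙ m n) →
          Exactly p f (ρ (n !)) → Splitting p (aₙ m n) r
        assemble e v′ f (t , n!≡ , p∤t) (b , aₙ≡ , p∤b) (u , ρ[n!]≡ , p∤u) =
          splitting-intro S r T p∤b (trans aₙ≡ (cong (λ k → p ^ k * b) n+e+v′≡S+r)) r≤S exactly-S
            (∣-trans (coprime-part-∣ρ n (n + e + v′) f u p∤b aₙ≡ ρ[n!]≡) (ρ-mono-∣ _ T n!u^n∣T))
          where
          i S T : ℕ
          -- The value of i is forced by `S` + r being the valuation of aₙ. Passing from p to p pⁱ
          -- raises the valuation of `ρ` from 2 + v to `S`, and t uⁿ does not change it. Since i ≥
          -- e, n! uⁿ still divides `T`.
          i = o + v′ + e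
          S = i + (2 + v)
          T = p * p ^ i * (t * u ^ n)

          n+e+v′≡S+r : n + e + v′ ≡ S + r
          n+e+v′≡S+r = trans (cong (λ k → k + e + v′) (sym o+≡n)) (lemma o v v′ r e)
            where
            lemma : ∀ o v v′ r e → o + (2 + v + r) + e + v′ ≡ o + v′ + e + (2 + v) + r
            lemma = solve-∀

          r≤S : r ≤ S
          r≤S = begin
            r                  ≤⟨ m+n≤o⇒m≤o∸n r r+≤n ⟩
            o                  ≤⟨ m≤m+n o (v′ + e) ⟩
            o + (v′ + e)       ≡⟨ +-assoc o v′ e ⟨
            i                  ≤⟨ m≤m+n i (2 + v) ⟩
            S                  ∎
            where open ≤-Reasoning

          exactly-S : Exactly p S (ρ T)
          exactly-S = Exactly-ρ-*-coprime (p * p ^ i)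
            (≤-trans (s≤s z≤n) (m≤n+m (2 + v) i)) (∤-* pr p∤t (∤-^ pr p∤u n))
            (Exactly-ρ-*-p^ p (s≤s (s≤s z≤n)) ρ[p] i)

          n!u^n∣T : n ! * u ^ n ∣ T
          n!u^n∣T = subst₂ _∣_ (cong (_* u ^ n) (sym n!≡)) eq (n∣m*n (p * p ^ (o + v′)))
            where
            lemma : ∀ p P E t U → p * P * (E * t * U) ≡ p * (P * E) * (t * U)
            lemma = solve-∀
            eq : p * p ^ (o + v′) * (p ^ e * t * u ^ n) ≡ T
            eq = trans (lemma p (p ^ (o + v′)) (p ^ e) t (u ^ n))
              (cong (λ P → p * P * (t * u ^ n)) (sym (^-distribˡ-+-* p (o + v′) e)))

      bound : ∃[ v ] Exactly p (2 + v) (ρ p) → ∃[ N ] ∀ n → N ≤ n → Splitting p (aₙ m n) r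
      bound (v , ρ[p]) = 2 + v + (r + r) , λ n N≤n →
        let e , exact-n! , p^∣aₙ = p^n*n!-part∣aₙ n
            v′ , exact-aₙ = valuation-≥ pr (n + e) (aₙ≢0 m n) p^∣aₙ
            f , exact-ρ = valuation pr (ρ (n !)) {{ρ≢0 (n !) {{n !≢0}}}}
        in assemble v ρ[p] n N≤n e v′ f exact-n! exact-aₙ exact-ρ

    -- Every digit occurs once a splitting exists.

    -- Some power of m is congruent to 1 + g k modulo a, with k chosen so that (1 + g k) / a lies in
    -- the interval [d/m, (d + 1)/m).
    splitting-digits : ∀ a .{{_ : NonZero a}} → Splitting p a (2 * m) →
      ∀ d → d < m → ∃[ N ] (m ^ suc N / a) % m ≡ d
    splitting-digits a (T , g , z , a≡ , ρT≡ , p∤z , divides g′ g≡) d d<m =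
      let t , y′ , y , tz≡ = solve-linear-congruence (∤⇒coprime-^ pr p∤z (2 * m)) k
          c , ρTt≡ = ρ-* T t
      in T * t , digit t y′ y c tz≡ ρTt≡
      where
      P q k : ℕ
      P = p ^ (2 * m)
      -- Rounding d P / m down and adding 1 ensures d P ≤ k m, the lower end of the interval.
      q = d * P / m
      k = suc q

      instance
        g≢0 : NonZero g
        g≢0 = m*n≢0⇒m≢0 g {{subst NonZero a≡ it}}

      lo : d * a ≤ m * (1 + g * k)
      lo = begin
        d * a                      ≡⟨ cong (d *_) a≡ ⟩
        d * (g * P)                ≡⟨ lemma d g P ⟩
        g * (d * P)                ≡⟨ cong (g *_) (m≡m%n+[m/n]*n (d * P) m) ⟩
        g * (d * P % m + q * m)    ≤⟨ *-monoʳ-≤ g (+-monoˡ-≤ (q * m) (m%n≤n (d * P) m)) ⟩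
        g * (k * m)                ≡⟨ lemma′ g k m ⟩
        m * (g * k)                ≤⟨ *-monoʳ-≤ m (n≤1+n (g * k)) ⟩
        m * (1 + g * k)            ∎
        where
        open ≤-Reasoning
        lemma : ∀ d g P → d * (g * P) ≡ g * (d * P)
        lemma = solve-∀
        lemma′ : ∀ g k m → g * (k * m) ≡ m * (g * k)
        lemma′ = solve-∀

      -- Replacing the summand 1 by g and rounding up in k cost at most 2 m together, and 2 m < p^(2
      -- m) = P.
      hi : m * (1 + g * k) < suc d * a
      hi = begin-strict
        m * (1 + g * k)       ≤⟨ *-monoʳ-≤ m (+-monoˡ-≤ (g * k) (>-nonZero⁻¹ g)) ⟩
        m * (g + g * suc q)   ≡⟨ lemma m g q ⟩
        g * (2 * m + q * m)   <⟨ *-monoʳ-< g (+-mono-<-≤ (n<a^n 1<p (2 * m)) (m/n*n≤m (d * P) m)) ⟩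
        g * (P + d * P)       ≡⟨ lemma′ g d P ⟩
        suc d * (g * P)       ≡⟨ cong (suc d *_) a≡ ⟨
        suc d * a             ∎
        where
        open ≤-Reasoning
        1<p : 1 < p
        1<p = nonTrivial⇒n>1 p {{prime⇒nonTrivial pr}}
        lemma : ∀ m g q → m * (g + g * suc q) ≡ g * (2 * m + q * m)
        lemma = solve-∀
        lemma′ : ∀ g d P → g * (P + d * P) ≡ suc d * (g * P)
        lemma′ = solve-∀

      module _ (t y′ y c : ℕ) (tz≡ : t * z + y′ * P ≡ k + y * P)
               (ρTt≡ : ρ (T * t) ≡ ρ T * (t + ρ T * c)) where

        -- Because g = g′ P, the second-order term g z c equals w P. Multiplied by g z it becomes z
        -- w a, which vanishes modulo a.
        w : ℕ
        w = g′ * z * c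

        expansion : m ^ (T * t) + y′ * a ≡ 1 + g * k + (y + z * w) * a
        expansion = begin
          m ^ (T * t) + y′ * a
            ≡⟨ cong (λ u → u + y′ * a) (1+ρ (T * t)) ⟨
          1 + ρ (T * t) + y′ * a
            ≡⟨ cong₂ (λ r b → 1 + r + y′ * b) ρTt≡ a≡ ⟩
          1 + ρ T * (t + ρ T * c) + y′ * (g * P)
            ≡⟨ cong (λ r → 1 + r * (t + r * c) + y′ * (g * P)) ρT≡ ⟩
          1 + g * z * (t + g * z * c) + y′ * (g * P)
            ≡⟨ lemma₁ g z t (g * z * c) y′ P ⟩
          1 + g * (t * z + y′ * P + z * (g * z * c))
            ≡⟨ cong₂ (λ X Y → 1 + g * (X + z * Y)) tz≡ gzc≡ ⟩
          1 + g * (k + y * P + z * (w * P))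
            ≡⟨ lemma₃ g k y z w P ⟩
          1 + g * k + (y + z * w) * (g * P)
            ≡⟨ cong (λ b → 1 + g * k + (y + z * w) * b) a≡ ⟨
          1 + g * k + (y + z * w) * a
            ∎
          where
          open ≡-Reasoning
          lemma₁ : ∀ g z t s y′ P → 1 + g * z * (t + s) + y′ * (g * P) ≡ 1 + g * (t * z + y′ * P + z * s)
          lemma₁ = solve-∀
          lemma₂ : ∀ g′ z c P → g′ * P * z * c ≡ g′ * z * c * P
          lemma₂ = solve-∀
          lemma₃ : ∀ g k y z w P → 1 + g * (k + y * P + z * (w * P)) ≡ 1 + g * k + (y + z * w) * (g * P)
          lemma₃ = solve-∀
          gzc≡ : g * z * c ≡ w * P
          gzc≡ = trans (cong (λ x → x * z * c) g≡) (lemma₂ g′ z c P)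

        digit : (m ^ suc (T * t) / a) % m ≡ d
        digit = begin
          (m * m ^ (T * t) / a) % m      ≡⟨ digit-≡-mod (y + z * w) y′ a expansion ⟩
          (m * (1 + g * k) / a) % m      ≡⟨ cong (_% m) ([x/a]-unique a lo hi) ⟩
          d % m                          ≡⟨ m<n⇒m%n≡m d<m ⟩
          d                              ∎
          where open ≡-Reasoning

-- Order and limits of rationals.

p≤∣p∣ : ∀ p → p ℚ.≤ ℚ.∣ p ∣
p≤∣p∣ p with ℚ.≤-total 0ℚ p
... | inj₁ 0≤p = ℚ.≤-reflexive (sym (ℚ.0≤p⇒∣p∣≡p 0≤p))
... | inj₂ p≤0 = ℚ.≤-trans p≤0 (ℚ.0≤∣p∣ p)

∣p-q∣≡∣q-p∣ : ∀ p q → ℚ.∣ p ℚ.- q ∣ ≡ ℚ.∣ q ℚ.- p ∣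
∣p-q∣≡∣q-p∣ p q =
  trans (sym (ℚ.∣-p∣≡∣p∣ (p ℚ.- q))) (cong ℚ.∣_∣ (⁻¹-anti-homo-// ℚ.+-0-group p q))

p<q⇒0<q-p : ∀ {p q} → p ℚ.< q → 0ℚ ℚ.< q ℚ.- p
p<q⇒0<q-p {p} {q} p<q =
  subst (ℚ._< q ℚ.- p) (ℚ.+-inverseʳ p) (ℚ.+-monoˡ-< (ℚ.- p) p<q)

p≤q⇒0≤q-p : ∀ {p q} → p ℚ.≤ q → 0ℚ ℚ.≤ q ℚ.- p
p≤q⇒0≤q-p {p} {q} p≤q =
  subst (ℚ._≤ q ℚ.- p) (ℚ.+-inverseʳ p) (ℚ.+-monoˡ-≤ (ℚ.- p) p≤q)

p-q<r⇒p<r+q : ∀ {p q r} → p ℚ.- q ℚ.< r → p ℚ.< r ℚ.+ q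
p-q<r⇒p<r+q {p} {q} {r} p-q<r =
  subst (ℚ._< r ℚ.+ q) (//-rightDividesˡ ℚ.+-0-group q p) (ℚ.+-monoˡ-< q p-q<r)

p<r+q⇒p-q<r : ∀ {p q r} → p ℚ.< r ℚ.+ q → p ℚ.- q ℚ.< r
p<r+q⇒p-q<r {p} {q} {r} p<r+q =
  subst (p ℚ.- q ℚ.<_) (//-rightDividesʳ ℚ.+-0-group q r) (ℚ.+-monoˡ-< (ℚ.- q) p<r+q)

limit-≥ : ∀ {s x q N} → s ⟶ x → (∀ n → N ≤ n → q ℚ.≤ s n) → q ℚ.≤ x
limit-≥ {s} {x} {q} {N} s⟶x q≤s = ℚ.≮⇒≥ λ x<q →
  let N′ , near = s⟶x (q ℚ.- x) (p<q⇒0<q-p x<q)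
      n = N ⊔ N′
      s<q = subst (s n ℚ.<_) (//-rightDividesˡ ℚ.+-0-group x q)
        (p-q<r⇒p<r+q (ℚ.≤-<-trans (p≤∣p∣ _) (near n (m≤n⊔m N N′))))
  in ℚ.<-irrefl refl (ℚ.<-≤-trans s<q (q≤s n (m≤m⊔n N N′)))

limit-≤ : ∀ {s x q N} → s ⟶ x → (∀ n → N ≤ n → s n ℚ.≤ q) → x ℚ.≤ q
limit-≤ {s} {x} {q} {N} s⟶x s≤q = ℚ.≮⇒≥ λ q<x →
  let N′ , near = s⟶x (x ℚ.- q) (p<q⇒0<q-p q<x)
      n = N ⊔ N′
      x<x-q+s = p-q<r⇒p<r+q (ℚ.≤-<-trans (p≤∣p∣ _)
        (subst (ℚ._< x ℚ.- q) (∣p-q∣≡∣q-p∣ (s n) x) (near n (m≤n⊔m N N′))))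
      x<x = ℚ.<-≤-trans x<x-q+s (subst (x ℚ.- q ℚ.+ s n ℚ.≤_) (//-rightDividesˡ ℚ.+-0-group q x)
        (ℚ.+-monoʳ-≤ (x ℚ.- q) (s≤q n (m≤m⊔n N N′))))
  in ℚ.<-irrefl refl x<x

-- Fractions compared by cross-multiplication.

/-≤⁺ : ∀ i d j e .{{_ : NonZero d}} .{{_ : NonZero e}} → i * e ≤ j * d → + i ℚ./ d ℚ.≤ + j ℚ./ e
/-≤⁺ i d@(suc d-1) j e@(suc e-1) le = ℚ.toℚᵘ-cancel-≤
  (ℚᵘ.≤-respˡ-≃ (ℚᵘ.≃-sym (ℚ.toℚᵘ-fromℚᵘ (mkℚᵘ (+ i) d-1)))
  (ℚᵘ.≤-respʳ-≃ (ℚᵘ.≃-sym (ℚ.toℚᵘ-fromℚᵘ (mkℚᵘ (+ j) e-1)))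
  (*≤* (subst₂ ℤ._≤_ (ℤ.pos-* i e) (ℤ.pos-* j d) (ℤ.+≤+ le)))))

/-≤⁻ : ∀ i d j e .{{_ : NonZero d}} .{{_ : NonZero e}} → + i ℚ./ d ℚ.≤ + j ℚ./ e → i * e ≤ j * d
/-≤⁻ i d@(suc d-1) j e@(suc e-1) le = ℤ.drop‿+≤+
  (subst₂ ℤ._≤_ (sym (ℤ.pos-* i e)) (sym (ℤ.pos-* j d)) (ℚᵘ.drop-*≤*
    (ℚᵘ.≤-respˡ-≃ (ℚ.toℚᵘ-fromℚᵘ (mkℚᵘ (+ i) d-1))
    (ℚᵘ.≤-respʳ-≃ (ℚ.toℚᵘ-fromℚᵘ (mkℚᵘ (+ j) e-1)) (ℚ.toℚᵘ-mono-≤ le)))))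

module _ (i d j e : ℕ) .{{_ : NonZero d}} .{{_ : NonZero e}} where

  /-<⁺ : i * e < j * d → + i ℚ./ d ℚ.< + j ℚ./ e
  /-<⁺ lt = ℚ.≰⇒> (<⇒≱ lt ∘ /-≤⁻ j e i d)

  /-≡⁺ : i * e ≡ j * d → + i ℚ./ d ≡ + j ℚ./ e
  /-≡⁺ eq = ℚ.≤-antisym (/-≤⁺ i d j e (≤-reflexive eq)) (/-≤⁺ j e i d (≤-reflexive (sym eq)))

/-+-/ : ∀ i j d .{{_ : NonZero d}} → + i ℚ./ d ℚ.+ + j ℚ./ d ≡ + (i + j) ℚ./ d
/-+-/ i j d@(suc d-1) = ℚ.toℚᵘ-injective (begin
  ℚ.toℚᵘ (+ i ℚ./ d ℚ.+ + j ℚ./ d)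
    ≈⟨ ℚ.toℚᵘ-homo-+ (+ i ℚ./ d) (+ j ℚ./ d) ⟩
  ℚ.toℚᵘ (+ i ℚ./ d) ℚᵘ.+ ℚ.toℚᵘ (+ j ℚ./ d)
    ≈⟨ ℚᵘ.+-cong (ℚ.toℚᵘ-fromℚᵘ (mkℚᵘ (+ i) d-1)) (ℚ.toℚᵘ-fromℚᵘ (mkℚᵘ (+ j) d-1)) ⟩
  mkℚᵘ (+ i) d-1 ℚᵘ.+ mkℚᵘ (+ j) d-1
    ≈⟨ ℚᵘ.*≡* eq ⟩
  mkℚᵘ (+ (i + j)) d-1
    ≈⟨ ℚ.toℚᵘ-fromℚᵘ (mkℚᵘ (+ (i + j)) d-1) ⟨
  ℚ.toℚᵘ (+ (i + j) ℚ./ d)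
    ∎)
  where
  open ℚᵘ.≃-Reasoning
  eq : (+ i ℤ.* + d ℤ.+ + j ℤ.* + d) ℤ.* + d ≡ + (i + j) ℤ.* + (d * d)
  eq = trans (cong (ℤ._* + d) (sym (ℤ.*-distribʳ-+ (+ d) (+ i) (+ j))))
        (trans (ℤ.*-assoc (+ (i + j)) (+ d) (+ d)) (cong (+ (i + j) ℤ.*_) (sym (ℤ.pos-* d d))))

-- The bound is the denominator of ε, whose numerator is at least 1.
archimedean : ∀ {ε} → 0ℚ ℚ.< ε → ∃[ N ] ∀ n .{{_ : NonZero n}} → N < n → + 1 ℚ./ n ℚ.< ε
archimedean {mkℚ (+ zero) _ _}  (*<* (ℤ.+<+ ()))
archimedean {mkℚ ℤ.-[1+ _ ] _ _} (*<* ())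
archimedean {ε@(mkℚ +[1+ k ] d-1 _)} _ = suc d-1 , λ n d<n →
  subst (+ 1 ℚ./ n ℚ.<_) (ℚ.↥p/↧p≡p ε) (/-<⁺ 1 n (suc k) (suc d-1)
    (<-≤-trans (subst (_< n) (sym (*-identityˡ (suc d-1))) d<n) (m≤n*m n (suc k))))

-- Base-m expansions and their truncations.

module _ (m : ℕ) .{{_ : NonTrivial m}} where

  private instance
    m≢0 : NonZero m
    m≢0 = nonTrivial⇒nonZero m

  private
    m^≢0 : ∀ n → NonZero (m ^ n)
    m^≢0 n = m^n≢0 m n

    infixl 7 _/m^_

    _/m^_ : ℕ → ℕ → ℚ
    i /m^ n = ℚ._/_ (+ i) (m ^ n) {{m^≢0 n}}

  -- ∑_{j = 1}^{n} b j m^(n - j)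
  truncation : (ℕ → Fin m) → ℕ → ℕ
  truncation b zero    = 0
  truncation b (suc n) = m * truncation b n + toℕ (b (suc n))

  partialSum≡ : ∀ b n → partialSum (λ j → digitTerm m (b j) j) n ≡ truncation b n /m^ n
  partialSum≡ b zero    = refl
  partialSum≡ b (suc n) = begin
    partialSum (λ j → digitTerm m (b j) j) n ℚ.+ d /m^ suc n
      ≡⟨ cong (λ s → s ℚ.+ d /m^ suc n) (partialSum≡ b n) ⟩
    t /m^ n ℚ.+ d /m^ suc n
      ≡⟨ cong (λ s → s ℚ.+ d /m^ suc n)
           (/-≡⁺ t (m ^ n) (m * t) (m ^ suc n) {{m^≢0 n}} {{m^≢0 (suc n)}} (lemma t m (m ^ n))) ⟩
    (m * t) /m^ suc n ℚ.+ d /m^ suc n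
      ≡⟨ /-+-/ (m * t) d (m ^ suc n) {{m^≢0 (suc n)}} ⟩
    truncation b (suc n) /m^ suc n
      ∎
    where
    open ≡-Reasoning
    t d : ℕ
    t = truncation b n
    d = toℕ (b (suc n))
    lemma : ∀ t m M → t * (m * M) ≡ m * t * M
    lemma = solve-∀

  truncation-lower : ∀ b n k → truncation b n * m ^ k ≤ truncation b (k + n)
  truncation-lower b n zero    = ≤-reflexive (*-identityʳ _)
  truncation-lower b n (suc k) = begin
    t * (m * m ^ k)                ≡⟨ lemma t m (m ^ k) ⟩
    m * (t * m ^ k)                ≤⟨ *-monoʳ-≤ m (truncation-lower b n k) ⟩
    m * truncation b (k + n)       ≤⟨ m≤m+n _ _ ⟩
    truncation b (suc k + n)       ∎
    where
    open ≤-Reasoning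
    t : ℕ
    t = truncation b n
    lemma : ∀ t m M → t * (m * M) ≡ m * (t * M)
    lemma = solve-∀

  -- The successor on the left carries the induction: a digit is at most m - 1, so m t′ plus a digit
  -- plus 1 is at most m (t′ + 1).
  truncation-upper : ∀ b n k → suc (truncation b (k + n)) ≤ suc (truncation b n) * m ^ k
  truncation-upper b n zero    = ≤-reflexive (sym (*-identityʳ _))
  truncation-upper b n (suc k) = begin
    suc (m * t′ + toℕ (b (suc (k + n))))    ≡⟨ +-suc (m * t′) _ ⟨
    m * t′ + suc (toℕ (b (suc (k + n))))    ≤⟨ +-monoʳ-≤ (m * t′) (toℕ<n (b (suc (k + n)))) ⟩
    m * t′ + m                              ≡⟨ lemma₁ m t′ ⟩
    m * suc t′                              ≤⟨ *-monoʳ-≤ m (truncation-upper b n k) ⟩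
    m * (suc t * m ^ k)                     ≡⟨ lemma₂ t m (m ^ k) ⟩
    suc t * (m * m ^ k)                     ∎
    where
    open ≤-Reasoning
    t t′ : ℕ
    t = truncation b n
    t′ = truncation b (k + n)
    lemma₁ : ∀ m t → m * t + m ≡ m * suc t
    lemma₁ = solve-∀
    lemma₂ : ∀ t m M → m * (suc t * M) ≡ suc t * (m * M)
    lemma₂ = solve-∀

  module _ (b : ℕ → Fin m) {x : ℚ} (s⟶x : partialSum (λ j → digitTerm m (b j) j) ⟶ x) (n : ℕ) where

    private
      t : ℕ → ℕ
      t = truncation b

      cross-≤ : ∀ {u v} k → u * m ^ k ≤ v → u * m ^ (k + n) ≤ v * m ^ n
      cross-≤ {u} {v} k u≤v = subst (_≤ v * m ^ n)
        (trans (*-assoc u _ _) (cong (u *_) (sym (^-distribˡ-+-* m k n)))) (*-monoˡ-≤ (m ^ n) u≤v)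

      cross-≥ : ∀ {u v} k → v ≤ u * m ^ k → v * m ^ n ≤ u * m ^ (k + n)
      cross-≥ {u} {v} k v≤u = subst (v * m ^ n ≤_)
        (trans (*-assoc u _ _) (cong (u *_) (sym (^-distribˡ-+-* m k n)))) (*-monoˡ-≤ (m ^ n) v≤u)

      partialSums : ℕ → ℚ
      partialSums = partialSum (λ j → digitTerm m (b j) j)

    limit-lower : t n /m^ n ℚ.≤ x
    limit-lower = limit-≥ {N = n} s⟶x λ n′ n≤n′ →
      subst (λ l → t n /m^ n ℚ.≤ partialSums l) (m∸n+n≡m n≤n′) (step (n′ ∸ n))
      where
      step : ∀ k → t n /m^ n ℚ.≤ partialSums (k + n)
      step k = subst (t n /m^ n ℚ.≤_) (sym (partialSum≡ b (k + n)))
        (/-≤⁺ (t n) (m ^ n) (t (k + n)) (m ^ (k + n)) {{m^≢0 n}} {{m^≢0 (k + n)}}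
          (cross-≤ {t n} k (truncation-lower b n k)))

    limit-upper : x ℚ.≤ suc (t n) /m^ n
    limit-upper = limit-≤ {N = n} s⟶x λ n′ n≤n′ →
      subst (λ l → partialSums l ℚ.≤ suc (t n) /m^ n) (m∸n+n≡m n≤n′) (step (n′ ∸ n))
      where
      step : ∀ k → partialSums (k + n) ℚ.≤ suc (t n) /m^ n
      step k = subst (ℚ._≤ suc (t n) /m^ n) (sym (partialSum≡ b (k + n)))
        (/-≤⁺ (t (k + n)) (m ^ (k + n)) (suc (t n)) (m ^ n) {{m^≢0 (k + n)}} {{m^≢0 n}}
          (cross-≥ {suc (t n)} k (≤-trans (n≤1+n _) (truncation-upper b n k))))

  -- The digits of 1/a and membership in the missing-digit set.

  module _ (a : ℕ) .{{_ : NonZero a}} where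

    -- The (n + 1)-st digit of 1 / a.
    digit : ℕ → Fin m
    digit n = (m ^ suc n / a) mod m

    toℕ-digit : ∀ n → toℕ (digit n) ≡ (m ^ suc n / a) % m
    toℕ-digit n = toℕ-fromℕ< (m%n<n (m ^ suc n / a) m)

    [m^1+n/a]/m≡m^n/a : ∀ n → m ^ suc n / a / m ≡ m ^ n / a
    [m^1+n/a]/m≡m^n/a n = begin
      m * m ^ n / a / m      ≡⟨ m/n/o≡m/[n*o] (m * m ^ n) a m ⟩
      m * m ^ n / (a * m)    ≡⟨ /-congʳ (*-comm a m) ⟩
      m * m ^ n / (m * a)    ≡⟨ m*n/m*o≡n/o m (m ^ n) a ⟩
      m ^ n / a              ∎
      where
      open ≡-Reasoning
      instance
        a*m≢0 : NonZero (a * m)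
        a*m≢0 = m*n≢0 a m
        m*a≢0 : NonZero (m * a)
        m*a≢0 = m*n≢0 m a

    [m^1+n/a]≡ : ∀ n → m ^ suc n / a ≡ m * (m ^ n / a) + toℕ (digit n)
    [m^1+n/a]≡ n = begin
      x
        ≡⟨ m≡m%n+[m/n]*n x m ⟩
      x % m + x / m * m
        ≡⟨ cong₂ (λ r q → r + q * m) (sym (toℕ-digit n)) ([m^1+n/a]/m≡m^n/a n) ⟩
      toℕ (digit n) + m ^ n / a * m
        ≡⟨ lemma (toℕ (digit n)) (m ^ n / a) m ⟩
      m * (m ^ n / a) + toℕ (digit n)
        ∎
      where
      open ≡-Reasoning
      x : ℕ
      x = m ^ suc n / a
      lemma : ∀ d q m → d + q * m ≡ m * q + d
      lemma = solve-∀

    -- The hypothesis makes the expansion of 1 / a unique.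
    module _ (a∤m^n : ∀ n → a ∤ m ^ n) (D : Subset m) where

      -- The limit bounds give t a ≤ mⁿ ≤ (t + 1) a for the n-th truncation t. Equality on the right
      -- would make a divide mⁿ, so t is the integer part of mⁿ / a, and successive truncations
      -- determine the digits.
      K⇒digits : K m D (+ 1 ℚ./ a) → ∀ n → digit n ∈ D
      K⇒digits (b , b∈D , s⟶) n = subst (_∈ D) (toℕ-injective b≡digit) (b∈D (suc n) (s≤s z≤n))
        where
        t : ℕ → ℕ
        t = truncation b
        floor : ∀ n → m ^ n / a ≡ t n
        floor n = [x/a]-unique {d = t n} a
          (subst (t n * a ≤_) (*-identityˡ _)
            (/-≤⁻ (t n) (m ^ n) 1 a {{m^≢0 n}} (limit-lower b s⟶ n)))
          (≤∧≢⇒< (subst (_≤ suc (t n) * a) (*-identityˡ _)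
            (/-≤⁻ 1 a (suc (t n)) (m ^ n) {{it}} {{m^≢0 n}} (limit-upper b s⟶ n)))
            (λ eq → a∤m^n n (divides (suc (t n)) eq)))
        b≡digit : toℕ (b (suc n)) ≡ toℕ (digit n)
        b≡digit = +-cancelˡ-≡ (m * t n) _ _ (begin
          m * t n + toℕ (b (suc n))         ≡⟨ floor (suc n) ⟨
          m ^ suc n / a                     ≡⟨ [m^1+n/a]≡ n ⟩
          m * (m ^ n / a) + toℕ (digit n)   ≡⟨ cong (λ u → m * u + toℕ (digit n)) (floor n) ⟩
          m * t n + toℕ (digit n)           ∎)
          where open ≡-Reasoning

      digits⇒K : (∀ n → digit n ∈ D) → K m D (+ 1 ℚ./ a)
      digits⇒K digit∈D = b , (λ { (suc n) _ → digit∈D n }) , converges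
        where
        b : ℕ → Fin m
        -- The series starts at index 1, `digit` at index 0.
        b n = digit (pred n)

        floor : ∀ n → truncation b n ≡ m ^ n / a
        -- The integer part of 1/a is 0, because a = 1 would divide m⁰.
        floor zero    = sym (m<n⇒m/n≡0 (≤∧≢⇒< (>-nonZero⁻¹ a) λ { refl → a∤m^n 0 ∣-refl }))
        floor (suc n) = trans (cong (λ u → m * u + toℕ (digit n)) (floor n)) (sym ([m^1+n/a]≡ n))

        converges : partialSum (λ j → digitTerm m (b j) j) ⟶ + 1 ℚ./ a
        converges ε 0<ε =
          -- The error lies between 0 and 1/mⁿ, and mⁿ > n ≥ N.
          let N , 1/n<ε = archimedean 0<ε
          in N , λ n N≤n → subst (λ s → ℚ.∣ s ℚ.- + 1 ℚ./ a ∣ ℚ.< ε) (sym (partialSum≡ b n))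
               (near n (1/n<ε (m ^ n) {{m^≢0 n}} (≤-<-trans N≤n (n<a^n (nonTrivial⇒n>1 m) n))))
          where
          near : ∀ n → 1 /m^ n ℚ.< ε → ℚ.∣ truncation b n /m^ n ℚ.- + 1 ℚ./ a ∣ ℚ.< ε
          near n 1/m^n<ε = subst (ℚ._< ε)
            (sym (trans (∣p-q∣≡∣q-p∣ (t /m^ n) (+ 1 ℚ./ a)) (ℚ.0≤p⇒∣p∣≡p (p≤q⇒0≤q-p lower))))
            (p<r+q⇒p-q<r (ℚ.<-trans upper (ℚ.+-monoˡ-< (t /m^ n) 1/m^n<ε)))
            where
            t M : ℕ
            t = truncation b n
            M = m ^ n
            lower : t /m^ n ℚ.≤ + 1 ℚ./ a
            lower = /-≤⁺ t M 1 a {{m^≢0 n}}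
              (subst₂ _≤_ (cong (_* a) (sym (floor n))) (sym (*-identityˡ M)) (m/n*n≤m M a))
            upper : + 1 ℚ./ a ℚ.< 1 /m^ n ℚ.+ t /m^ n
            upper = subst (+ 1 ℚ./ a ℚ.<_) (sym (/-+-/ 1 t M {{m^≢0 n}}))
              (/-<⁺ 1 a (suc t) M {{it}} {{m^≢0 n}}
              (subst₂ _<_ (sym (*-identityˡ M)) (cong (λ u → suc u * a) (sym (floor n))) M<))
              where
              M< : M < suc (M / a) * a
              M< = subst (_< suc (M / a) * a) (sym (m≡m%n+[m/n]*n M a))
                (+-monoˡ-< (M / a * a) (m%n<n M a))

-- Prime divisors, finite listings and a missing digit.

∃-prime-divisor : ∀ n .{{_ : NonTrivial n}} → ∃[ p ] Prime p × p ∣ n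
∃-prime-divisor n = go (factorise n {{nonTrivial⇒nonZero n}})
  where
  go : PrimeFactorisation n → ∃[ p ] Prime p × p ∣ n
  go record { factors = []     ; isFactorisation = n≡1 } = contradiction n≡1 nonTrivial⇒≢1
  go record { factors = p ∷ ps ; isFactorisation = n≡  ; factorsPrime = pr ∷ _ } =
    p , pr , subst (p ∣_) (sym n≡) (m∣m*n _)

-- `Finite` demands a list with exactly the right entries, so the finitely many indices below `N`
-- are filtered by the decision procedure.
eventually-outside⇒Finite : ∀ {A : Set} {R P : Pred A 0ℓ} (f : ℕ → A) →
  (∀ n → R (f n)) → (∀ {x} → R x → ∃[ n ] x ≡ f n) →
  (∀ n → Dec (P (f n))) → ∀ N → (∀ n → N ≤ n → ¬ P (f n)) → Finite (R ∩ P)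
eventually-outside⇒Finite {R = R} {P} f R-f R⇒f P∘f? N outside = xs , λ x → mk⇔ to from
  where
  xs = map f (filter P∘f? (upTo N))

  to : ∀ {x} → (R ∩ P) x → x List.∈ xs
  to (r , px) with n , refl ← R⇒f r with n <? N
  ... | yes n<N = ∈-map⁺ f (∈-filter⁺ P∘f? (∈-upTo⁺ n<N) px)
  ... | no  n≮N = contradiction px (outside n (≮⇒≥ n≮N))

  from : ∀ {x} → x List.∈ xs → (R ∩ P) x
  from x∈xs with n , n∈ , refl ← ∈-map⁻ f x∈xs with _ , px ← ∈-filter⁻ P∘f? {xs = upTo N} n∈ =
    R-f n , px

∣p∣<n⇒∃∉ : ∀ {n} (D : Subset n) → ∣ D ∣ < n → ∃[ d ] ¬ (d ∈ D)
∣p∣<n⇒∃∉ {n} D ∣D∣<n = ¬∀⟶∃¬ n (_∈ D) (_∈? D) λ all∈D →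
  <⇒≱ ∣D∣<n (subst (_≤ ∣ D ∣) (∣⊤∣≡n n) (p⊆q⇒∣p∣≤∣q∣ {p = ⊤} λ {d} _ → all∈D d))

-- Periodicity of the digits and decidability.

module _ (m : ℕ) .{{_ : NonTrivial m}} where

  private instance
    m≢0 : NonZero m
    m≢0 = nonTrivial⇒nonZero m

  module _ (a T : ℕ) .{{_ : NonZero a}} .{{_ : NonZero T}} (a∣ρT : a ∣ ρ m T) where

    -- Since mᵀ ≡ 1 (mod a), the residues of the powers of m repeat with period T, and `digit-≡-mod`
    -- transfers this to the digits.
    digit-periodic : ∀ n k → digit m a (n + k * T) ≡ digit m a n
    digit-periodic n zero    = cong (digit m a) (+-identityʳ n)
    digit-periodic n (suc k) = trans (cong (digit m a) (lemma n k T))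
      (trans (step (n + k * T)) (digit-periodic n k))
      where
      lemma : ∀ n k T → n + (T + k * T) ≡ n + k * T + T
      lemma = solve-∀
      step : ∀ n → digit m a (n + T) ≡ digit m a n
      step n = toℕ-injective (trans (toℕ-digit m a (n + T))
        (trans (digit-≡-mod m (m ^ n * q) 0 a eq) (sym (toℕ-digit m a n))))
        where
        q : ℕ
        q = quotient a∣ρT
        lemma′ : ∀ M q a → M * (1 + q * a) ≡ M + M * q * a
        lemma′ = solve-∀
        eq : m ^ (n + T) + 0 * a ≡ m ^ n + m ^ n * q * a
        eq = begin
          m ^ (n + T) + 0               ≡⟨ +-identityʳ _ ⟩
          m ^ (n + T)                   ≡⟨ ^-distribˡ-+-* m n T ⟩
          m ^ n * m ^ T                 ≡⟨ cong (m ^ n *_) (1+ρ m T) ⟨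
          m ^ n * (1 + ρ m T)           ≡⟨ cong (λ r → m ^ n * (1 + r)) (m∣n⇒n≡quotient*m a∣ρT) ⟩
          m ^ n * (1 + q * a)           ≡⟨ lemma′ (m ^ n) q a ⟩
          m ^ n + m ^ n * q * a         ∎
          where open ≡-Reasoning

    digits∈? : ∀ D → Dec (∀ n → digit m a n ∈ D)
    digits∈? D = map′ extend (λ all {n} _ → all n) (allUpTo? (λ n → digit m a n ∈? D) T)
      where
      extend : (∀ {n} → n < T → digit m a n ∈ D) → ∀ n → digit m a n ∈ D
      extend all n = subst (_∈ D) (begin
        digit m a (n % T)                     ≡⟨ digit-periodic (n % T) (n / T) ⟨
        digit m a (n % T + n / T * T)         ≡⟨ cong (digit m a) (m≡m%n+[m/n]*n n T) ⟨
        digit m a n                           ∎)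
        (all (m%n<n n T))
        where open ≡-Reasoning

  -- Supplies a period: with h = `ρ m (n !)`, aₙ divides hⁿ, and h^(n + 1) divides the value of
  -- `ρ m` at n! hⁿ.
  aₙ∣ρ : ∀ n → ∃[ T ] NonZero T × aₙ m n ∣ ρ m T
  aₙ∣ρ n = n ! * ρ m (n !) ^ n , T≢0
    , ∣-trans (aₙ∣ρ^n m n ∣-refl) (∣-trans (n∣m*n (ρ m (n !))) (^∣ρ m (n !) ∣-refl n))
    where
    instance
      n!≢0 : NonZero (n !)
      n!≢0 = n !≢0
    T≢0 : NonZero (n ! * ρ m (n !) ^ n)
    T≢0 = m*n≢0 (n !) (ρ m (n !) ^ n) {{n!≢0}} {{m^n≢0 (ρ m (n !)) n {{ρ≢0 m (n !)}}}}

  -- The prime p divides aₙ for positive index, whereas mᵏ ≡ 1 (mod p).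
  aₙ∤m^k : ∀ {p} → Prime p → p ∣ ρ m 1 → ∀ n k → aₙ m (suc n) ∤ m ^ k
  aₙ∤m^k {p} pr p∣m-1 n k aₙ∣m^k = ∤-1 pr (∣m+n∣m⇒∣n p∣ρ+1 (p∣ρ k))
    where
    p∣ρ : ∀ k → p ∣ ρ m k
    p∣ρ k = ∣-trans p∣m-1 (ρ-mono-∣ m 1 k (1∣ k))
    p∣ρ+1 : p ∣ ρ m k + 1
    p∣ρ+1 = subst (p ∣_) (trans (sym (1+ρ m k)) (+-comm 1 (ρ m k)))
      (∣-trans (∣n⇒∣m*n (aₙ m n) (p∣ρ (suc n))) aₙ∣m^k)

proposition4p14 : (m : ℕ) .{{_ : NonTrivial m}} → 3 ≤ m →
    (D : Subset m) → 1 < ∣ D ∣ → ∣ D ∣ < m →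
    Finite (Reciprocals m ∩ K m D)
proposition4p14 m 3≤m D _ ∣D∣<m =
  finite (∃-prime-divisor (ρ m 1) {{ρ1-nonTrivial}}) (∣p∣<n⇒∃∉ D ∣D∣<m)
  where
  -- From m ≥ 3 comes m - 1 ≥ 2, so m - 1 has a prime divisor.
  ρ1-nonTrivial : NonTrivial (ρ m 1)
  ρ1-nonTrivial = n>1⇒nonTrivial (subst (λ x → 1 < x ∸ 1) (sym (^-identityʳ m)) (∸-monoˡ-≤ 1 3≤m))

  1/a : ℕ → ℚ
  1/a n = ℚ._/_ (+ 1) (aₙ m n) {{aₙ≢0 m n}}

  finite : ∃[ p ] Prime p × p ∣ ρ m 1 → ∃[ d ] ¬ (d ∈ D) → Finite (Reciprocals m ∩ K m D)
  finite (p , pr , p∣m-1) (d , d∉D) = listed (aₙ-splitting m pr p∣m-1 (2 * m))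
    where
    module _ (n : ℕ) where
      private instance
        a≢0 : NonZero (aₙ m (suc n))
        a≢0 = aₙ≢0 m (suc n)

      K⇒∈ : K m D (1/a (suc n)) → ∀ k → digit m (aₙ m (suc n)) k ∈ D
      K⇒∈ = K⇒digits m (aₙ m (suc n)) (aₙ∤m^k m pr p∣m-1 n) D

      K? : Dec (K m D (1/a (suc n)))
      K? = let T , T≢0 , a∣ρT = aₙ∣ρ m (suc n)
           in map′ (digits⇒K m (aₙ m (suc n)) (aₙ∤m^k m pr p∣m-1 n) D) K⇒∈
                (digits∈? m (aₙ m (suc n)) T {{a≢0}} {{T≢0}} a∣ρT D)

      splitting⇒¬K : Splitting m p (aₙ m (suc n)) (2 * m) → ¬ K m D (1/a (suc n))
      splitting⇒¬K s k∈ =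
        let N , digit≡d = splitting-digits m pr p∣m-1 (aₙ m (suc n)) s (toℕ d) (toℕ<n d)
        in d∉D (subst (_∈ D) (toℕ-injective (trans (toℕ-digit m (aₙ m (suc n)) N) digit≡d)) (K⇒∈ k∈ N))

    listed : ∃[ N ] (∀ n → N ≤ n → Splitting m p (aₙ m n) (2 * m)) → Finite (Reciprocals m ∩ K m D)
    listed (N , split) = eventually-outside⇒Finite (λ n → 1/a (suc n))
      -- The enumeration is shifted by one so that it starts with the reciprocal of index 1.
      (λ n → suc n , s≤s z≤n , refl) (λ { (suc n , _ , x≡) → n , x≡ }) K? N
      (λ n N≤n → splitting⇒¬K n (split (suc n) (≤-trans N≤n (n≤1+n n))))
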